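{- Let $G$ be a graph, let $p$ be a positive integer, and let $\ell$ be a $2$-intersecting supermodular weakly subadditive integer-valued function on subsets of $V(G)$ such that for any two adjacent vertices $u$ and $v$, $\ell(u)+\ell(v)=\ell(\{u,v\})+1$. Then $G$ is $p\ell$-rigid if and only if $G$ can be decomposed into $p$ edge-disjoint spanning $\ell$-rigid subgraphs (i.e. $E(G)$ can be partitioned into the edge sets of $p$ spanning $\ell$-rigid subgraphs).
   Context: Graphs are finite, loopless, multiple edges allowed. $e_H(X)$ is the number of edges of $H$ with both ends in $X$. Set functions are zero on $\emptyset$, $\ell(v)=\ell(\{v\})$; $p\ell$ denotes the function $X\mapsto p\,\ell(X)$. $\ell$ is $2$-intersecting supermodular if $\ell(A\cap B)+\ell(A\cup B)\ge\ell(A)+\ell(B)$ whenever $|A\cap B|\ge 2$; weakly subadditive if $\sum_{v\in A}\ell(v)\ge\ell(A)$ for all $A$. For a set function $f$, a graph $H$ is $f$-rigid if it has a spanning subgraph $F$ with $e_F(X)\le\sum_{v\in X}f(v)-f(X)$ for all $X\subseteq V(H)$ and $|E(F)|=\sum_{v\in V(H)}f(v)-f(V(H))$. -}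

module Defs where

open import Data.Nat as ℕ using (ℕ; zero; suc)
open import Data.Integer as ℤ using (ℤ; +_; _+_; _-_; _*_; _≤_)
open import Data.Fin using (Fin; zero; suc)
open import Data.Fin.Subset as S using (Subset; ⁅_⁆; _∩_; _∪_; _⊆_; ∣_∣; ⊤)
open import Data.Bool using (Bool; true; false; if_then_else_; _∧_)
open import Data.Vec using (lookup; tabulate)
import Data.Fin as Fin
open import Relation.Nullary.Decidable using (⌊_⌋)
open import Data.Product using (_×_; _,_; proj₁; proj₂; Σ)
open import Relation.Binary.PropositionalEquality using (_≡_; _≢_)

-- A loopless multigraph on vertex set Fin n with m edges, edge i joining
-- proj₁ (ends i) and proj₂ (ends i).  Parallel edges are allowed.
record Graph (n m : ℕ) : Set where
  field
    ends     : Fin m → Fin n × Fin n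
    loopless : (i : Fin m) → proj₁ (ends i) ≢ proj₂ (ends i)
open Graph public

SetFun : ℕ → Set
SetFun n = Subset n → ℤ

sumFin : {k : ℕ} → (Fin k → ℤ) → ℤ
sumFin {zero}  f = + 0
sumFin {suc k} f = f zero + sumFin (λ i → f (suc i))

pt : {n : ℕ} → SetFun n → Fin n → ℤ
pt ℓ v = ℓ ⁅ v ⁆

sumOver : {n : ℕ} → SetFun n → Subset n → ℤ
sumOver ℓ X = sumFin (λ v → if lookup X v then pt ℓ v else + 0)

scale : {n : ℕ} → ℕ → SetFun n → SetFun n
scale p ℓ X = + p * ℓ X

eIn : {n m : ℕ} → Graph n m → Subset m → Subset n → ℤ
eIn G F X = sumFin (λ i →
  if lookup F i ∧ lookup X (proj₁ (ends G i)) ∧ lookup X (proj₂ (ends G i))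
  then + 1 else + 0)

-- The spanning subgraph of G with edge set H (vertex set V(G) = Fin n)
-- is f-rigid: it has a spanning subgraph with edge set F ⊆ H such that
-- e_F(X) ≤ Σ_{v∈X} f(v) - f(X) for all X and |F| = Σ_{v∈V} f(v) - f(V).
Rigid : {n m : ℕ} → SetFun n → Graph n m → Subset m → Set
Rigid {n} f G H = Σ (Subset _) λ F →
  (F ⊆ H) ×
  ((X : Subset n) → eIn G F X ≤ sumOver f X - f X) ×
  (+ ∣ F ∣ ≡ sumOver f ⊤ - f ⊤)

ZeroOnEmpty : {n : ℕ} → SetFun n → Set
ZeroOnEmpty ℓ = ℓ S.⊥ ≡ + 0

TwoIntersectingSupermodular : {n : ℕ} → SetFun n → Set
TwoIntersectingSupermodular {n} ℓ = (A B : Subset n) → 2 ℕ.≤ ∣ A ∩ B ∣ →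
  ℓ A + ℓ B ≤ ℓ (A ∩ B) + ℓ (A ∪ B)

WeaklySubadditive : {n : ℕ} → SetFun n → Set
WeaklySubadditive {n} ℓ = (A : Subset n) → ℓ A ≤ sumOver ℓ A

AdjacencyCondition : {n m : ℕ} → Graph n m → SetFun n → Set
AdjacencyCondition {m = m} G ℓ = (i : Fin m) → pt ℓ (proj₁ (ends G i)) + pt ℓ (proj₂ (ends G i))
    ≡ ℓ (⁅ proj₁ (ends G i) ⁆ ∪ ⁅ proj₂ (ends G i) ⁆) + + 1

-- E(G) partitioned into p edge sets (colour classes of c : E(G) → Fin p),
-- each spanning an ℓ-rigid spanning subgraph of G.
edgeClass : {m p : ℕ} → (Fin m → Fin p) → Fin p → Subset m
edgeClass c j = tabulate (λ i → ⌊ c i Fin.≟ j ⌋)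

Decomposable : {n m : ℕ} → ℕ → SetFun n → Graph n m → Set
Decomposable {m = m} p ℓ G = Σ (Fin m → Fin p) λ c →
  (j : Fin p) → Rigid ℓ G (edgeClass c j)

{-# OPTIONS --safe #-}
module Submission where

-- Put g X = Σ_{v∈X} ℓ(v) − ℓ(X).  Then g is 2-intersecting submodular, and both
-- directions reduce to: if e_F ≤ p g then F splits into p sets I_j with e_{I_j} ≤ g
-- (all of them have the maximal size g(V) when |F| = p g(V)).
--
-- Suppose all of F except one edge is so coloured, and call moving to another
-- such colouring by giving the missing edge the colour of an edge that becomes
-- the missing one a step.  Let R be the set of edges that are missing in some
-- reachable colouring.  If no reachable colouring can be completed, then for
-- every colour j each edge of R lies in a tight set Y (e_{I_j}(Y) = g(Y)) whose
-- I_j-edges all belong to R: this holds when the edge is missing, and steps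
-- preserve it.  Uniting tight sets that share two vertices keeps both
-- properties, so R is covered by such sets pairwise sharing at most one vertex,
-- whence |R| ≤ p Σ g(Y) = p Σ e_{I_j}(Y) ≤ p |R ∩ I_j|.  Summing over j gives
-- |R| ≤ Σ_j |R ∩ I_j| = |R| − 1.
--
-- R is not obviously decidable, but the existence of a colouring is, so the
-- contradiction may be derived in the double-negation monad.

open import Defs
open import Data.Bool using (Bool; true; false; T; if_then_else_; _∧_; _∨_; not)
open import Data.Bool.Properties using (if-float; ∧-assoc; ∧-comm; ∧-zeroʳ; ∧-identityʳ; ¬-not)
import Data.Bool as Bool
open import Data.Empty using (⊥; ⊥-elim)
open import Data.Fin using (Fin; zero; suc; punchIn; punchOut; finToFun; funToFin; _≟_)
open import Data.Fin.Properties using (any?; all?; punchInᵢ≢i; nonZeroIndex; punchIn-punchOut; finToFun-funToFin; sequence)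
open import Data.Fin.Subset using (Subset; ⊤; _∩_; _∪_; _⊆_; _∈_; ∣_∣)
open import Data.Fin.Subset.Properties using (anySubset?; p⊂q⇒∣p∣<∣q∣; x∈⁅y⁆⇒x≡y; ∣⁅x⁆∣≡1; ∈⊤)
open import Data.Integer as ℤ using (ℤ)
import Data.Integer.Properties as ℤ
open import Data.Integer.Tactic.RingSolver using (solve-∀)
open import Data.Nat using (ℕ; zero; suc; _+_; _*_; _≤_; _<_; z≤n; NonZero; _≤?_; _<?_)
open import Data.Nat.Properties hiding (_≟_)
open import Data.Product using (_×_; _,_; proj₁; proj₂; ∃)
open import Data.Sum using (_⊎_; inj₁; inj₂; [_,_])
open import Data.Unit using (tt)
open import Data.Vec using ([]; _∷_; lookup; tabulate)
open import Data.Vec.Functional using (removeAt; updateAt)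
open import Data.Vec.Functional.Properties using (updateAt-updates; updateAt-minimal)
open import Data.Vec.Properties using (lookup-replicate; lookup-zipWith; lookup∘tabulate; []=⇒lookup; lookup⇒[]=)
open import Effect.Monad using (RawMonad)
open import Function.Base using (_∘_; const)
open import Function.Bundles using (_⇔_; mk⇔)
open import Relation.Binary.Construct.Closure.ReflexiveTransitive using (Star; ε; _◅_; _◅◅_)
open import Relation.Binary.PropositionalEquality using (_≡_; _≢_; _≗_; refl; sym; trans; cong; cong₂; subst; subst₂; module ≡-Reasoning)
open import Relation.Nullary using (Dec; yes; no; ¬_; does; contradiction)
open import Relation.Nullary.Decidable using (⌊_⌋; isYes≗does; toWitness; dec-true; dec-false; decidable-stable; map′; ¬¬-excluded-middle; ¬?; _×-dec_)
open import Relation.Nullary.Negation using (¬¬-Monad)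

open import Algebra.Properties.Semiring.Sum +-*-semiring
  using (sum; sum-cong-≗; sum-remove; sum-replicate-zero; ∑-distrib-+; ∑-comm; *-distribˡ-sum)

-- Counting

true≢false : {b : Bool} → b ≡ true → b ≢ false
true≢false refl ()

∧-true : ∀ {x y} → x ∧ y ≡ true → x ≡ true × y ≡ true
∧-true {true} {true} _ = refl , refl

+-squeeze : ∀ {a a′ b b′} → a ≤ a′ → b ≤ b′ → a′ + b′ ≤ a + b → a ≡ a′ × b ≡ b′
+-squeeze {a} {a′} {b} {b′} a≤ b≤ h =
  ≤-antisym a≤ (+-cancelʳ-≤ b′ a′ a (≤-trans h (+-monoʳ-≤ a b≤))) ,
  ≤-antisym b≤ (+-cancelˡ-≤ a′ b′ b (≤-trans h (+-monoˡ-≤ b a≤)))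

𝟙 : Bool → ℕ
𝟙 b = if b then 1 else 0

𝟙-mono : ∀ {a b} → (a ≡ true → b ≡ true) → 𝟙 a ≤ 𝟙 b
𝟙-mono {false} _ = z≤n
𝟙-mono {true}  h = ≤-reflexive (cong 𝟙 (sym (h refl)))

𝟙≤1 : ∀ b → 𝟙 b ≤ 1
𝟙≤1 b = 𝟙-mono {b} {true} (λ _ → refl)

sum-mono : ∀ {k} {f g : Fin k → ℕ} → (∀ i → f i ≤ g i) → sum f ≤ sum g
sum-mono {zero}  _ = z≤n
sum-mono {suc k} h = +-mono-≤ (h zero) (sum-mono (h ∘ suc))

sum-const : ∀ k x → sum {k} (λ _ → x) ≡ k * x
sum-const zero    x = refl
sum-const (suc k) x = cong (x +_) (sum-const k x)

-- Later applied to colour classes: each has at most `g ⊤` edges, so a total of `p * g ⊤` forces all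
-- of them to be full.
sum-saturated : ∀ {k} {f : Fin k → ℕ} {x} → (∀ i → f i ≤ x) → sum f ≡ k * x → ∀ i → f i ≡ x
sum-saturated {suc k} {f} {x} f≤x total = λ
  { zero    → proj₁ squeezed
  ; (suc i) → sum-saturated (f≤x ∘ suc) (proj₂ squeezed) i }
  where
  squeezed = +-squeeze (f≤x zero)
    (≤-trans (sum-mono (f≤x ∘ suc)) (≤-reflexive (sum-const k x)))
    (≤-reflexive (sym total))

-- Stated crosswise to avoid truncated subtraction: both sides are the common remainder plus `f a`
-- and `g a`.
sum-update : ∀ {k} (f g : Fin k → ℕ) a → (∀ i → i ≢ a → f i ≡ g i) →
  sum f + g a ≡ sum g + f a
sum-update {suc k} f g a agree = begin
  sum f + g a                    ≡⟨ cong (_+ g a) (sum-remove f) ⟩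
  f a + sum (removeAt f a) + g a ≡⟨ cong (λ s → f a + s + g a) (sum-cong-≗ λ i → agree _ (punchInᵢ≢i a i)) ⟩
  f a + sum (removeAt g a) + g a ≡⟨ +-comm _ (g a) ⟩
  g a + (f a + S)                ≡⟨ cong (g a +_) (+-comm (f a) S) ⟩
  g a + (S + f a)                ≡⟨ +-assoc (g a) S (f a) ⟨
  g a + S + f a                  ≡⟨ cong (_+ f a) (sum-remove g) ⟨
  sum g + f a                    ∎
  where
  open ≡-Reasoning
  S = sum (removeAt g a)

term≤sum : ∀ {k} (f : Fin k → ℕ) a → f a ≤ sum f
term≤sum {suc k} f a = ≤-trans (m≤m+n _ _) (≤-reflexive (sym (sum-remove f)))

sum-single : ∀ {k} (f : Fin k → ℕ) a → (∀ i → i ≢ a → f i ≡ 0) → sum f ≡ f a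
sum-single {k} f a h = begin
  sum f                       ≡⟨ +-identityʳ _ ⟨
  sum f + 0                   ≡⟨ sum-update f (λ _ → 0) a h ⟩
  sum {k} (λ _ → 0) + f a     ≡⟨ cong (_+ f a) (sum-replicate-zero k) ⟩
  f a                         ∎
  where open ≡-Reasoning

count : ∀ {k} → (Fin k → Bool) → ℕ
count f = sum (λ i → 𝟙 (f i))

count-cong : ∀ {k} {f g : Fin k → Bool} → f ≗ g → count f ≡ count g
count-cong h = sum-cong-≗ (cong 𝟙 ∘ h)

count-mono : ∀ {k} {f g : Fin k → Bool} → (∀ i → f i ≡ true → g i ≡ true) → count f ≤ count g
count-mono h = sum-mono (𝟙-mono ∘ h)

count-false : ∀ {k} {f : Fin k → Bool} → (∀ i → f i ≡ false) → count f ≡ 0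
count-false {k} h = trans (count-cong h) (sum-replicate-zero k)

count≡0⇒false : ∀ {k} (f : Fin k → Bool) → count f ≡ 0 → ∀ i → f i ≡ false
count≡0⇒false f h i with f i | term≤sum (λ i → 𝟙 (f i)) i
... | false | _ = refl
... | true  | t rewrite h = contradiction t λ ()

count-disjoint : ∀ {k} (f : Fin k → Bool) t → (∀ a → f a ≡ true → t ≡ true) →
  (∀ a b → a ≢ b → f a ≡ true → f b ≡ true → ⊥) → count f ≤ 𝟙 t
count-disjoint f t h disj with any? (λ a → f a Bool.≟ true)
... | no none = ≤-trans (≤-reflexive (count-false λ a → ¬-not (λ fa → none (a , fa)))) z≤n
... | yes (a , fa) = ≤-trans
  (≤-reflexive (sum-single _ a λ b b≢a → cong 𝟙 (¬-not (λ fb → disj b a b≢a fb fa))))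
  (𝟙-mono (h a))

remove : ∀ {k} → (Fin k → Bool) → Fin k → Fin k → Bool
remove f a i = f i ∧ not (does (i ≟ a))

remove-self : ∀ {k} (f : Fin k → Bool) a → remove f a a ≡ false
remove-self f a rewrite dec-true (a ≟ a) refl = ∧-zeroʳ (f a)

remove-other : ∀ {k} (f : Fin k → Bool) {a i} → i ≢ a → remove f a i ≡ f i
remove-other f {a} {i} i≢a rewrite dec-false (i ≟ a) i≢a = ∧-identityʳ (f i)

remove-true : ∀ {k} (f : Fin k → Bool) {a i} → remove f a i ≡ true → f i ≡ true × i ≢ a
remove-true f {a} {i} h = proj₁ (∧-true h) , λ { refl → true≢false h (remove-self f i) }

count-remove : ∀ {k} (f : Fin k → Bool) a → f a ≡ true → count f ≡ suc (count (remove f a))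
count-remove f a fa = begin
  count f                         ≡⟨ +-identityʳ _ ⟨
  count f + 0                     ≡⟨ cong (λ b → count f + 𝟙 b) (remove-self f a) ⟨
  count f + 𝟙 (remove f a a)      ≡⟨ sum-update _ (λ i → 𝟙 (remove f a i)) a (λ i i≢a → cong 𝟙 (sym (remove-other f i≢a))) ⟩
  count (remove f a) + 𝟙 (f a)    ≡⟨ cong (λ b → count (remove f a) + 𝟙 b) fa ⟩
  count (remove f a) + 1          ≡⟨ +-comm _ 1 ⟩
  suc (count (remove f a))        ∎
  where open ≡-Reasoning

class : ∀ {k p} → (Fin k → Bool) → (Fin k → Fin p) → Fin p → Fin k → Bool
class f c j i = f i ∧ does (c i ≟ j)

module _ {k p : ℕ} (f : Fin k → Bool) (c : Fin k → Fin p) where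

  class-same : ∀ {j i} → c i ≡ j → class f c j i ≡ f i
  class-same {j} {i} h rewrite dec-true (c i ≟ j) h = ∧-identityʳ (f i)

  class-other : ∀ {j i} → c i ≢ j → class f c j i ≡ false
  class-other {j} {i} h rewrite dec-false (c i ≟ j) h = ∧-zeroʳ (f i)

  class-false : ∀ {j i} → f i ≡ false → class f c j i ≡ false
  class-false h rewrite h = refl

  class-true : ∀ {j i} → class f c j i ≡ true → f i ≡ true × c i ≡ j
  class-true {j} {i} h with c i ≟ j
  ... | yes ci≡j = proj₁ (∧-true h) , ci≡j
  ... | no  _    = contradiction (∧-zeroʳ (f i)) (true≢false h)

  count-classes : sum (λ j → count (class f c j)) ≡ count f
  count-classes = trans (∑-comm (λ j i → 𝟙 (class f c j i)))
    (sum-cong-≗ λ i → trans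
      (sum-single (λ j → 𝟙 (class f c j i)) (c i) (λ j j≢ → cong 𝟙 (class-other (j≢ ∘ sym))))
      (cong 𝟙 (class-same refl)))

class-cong : ∀ {k p} {f f′ : Fin k → Bool} {c c′ : Fin k → Fin p} {i} →
  f i ≡ f′ i → c i ≡ c′ i → ∀ j → class f c j i ≡ class f′ c′ j i
class-cong p q j = cong₂ (λ b x → b ∧ does (x ≟ j)) p q

-- Sparse edge sets and tight vertex sets

-- Uncrossing for a single edge: `t` says whether it is in the edge set, the indices stand for its
-- two ends, and `a`, `b` for two vertex sets. The third summand on the left detects an edge inside
-- the union but inside neither set.
uncross-𝟙 : ∀ t a₁ a₂ b₁ b₂ →
  𝟙 (t ∧ a₁ ∧ a₂) + 𝟙 (t ∧ b₁ ∧ b₂)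
    + 𝟙 (t ∧ ((a₁ ∨ b₁) ∧ (a₂ ∨ b₂)) ∧ not (a₁ ∧ a₂ ∨ b₁ ∧ b₂))
  ≡ 𝟙 (t ∧ (a₁ ∧ b₁) ∧ (a₂ ∧ b₂)) + 𝟙 (t ∧ (a₁ ∨ b₁) ∧ (a₂ ∨ b₂))
uncross-𝟙 false _ _ _ _ = refl
uncross-𝟙 true true  true  true  true  = refl
uncross-𝟙 true true  true  true  false = refl
uncross-𝟙 true true  true  false true  = refl
uncross-𝟙 true true  true  false false = refl
uncross-𝟙 true true  false true  true  = refl
uncross-𝟙 true true  false true  false = refl
uncross-𝟙 true true  false false true  = refl
uncross-𝟙 true true  false false false = refl
uncross-𝟙 true false true  true  true  = refl
uncross-𝟙 true false true  true  false = refl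
uncross-𝟙 true false true  false _     = refl
uncross-𝟙 true false false true  true  = refl
uncross-𝟙 true false false true  false = refl
uncross-𝟙 true false false false _     = refl

two-members : ∀ {n} {X : Subset n} {u v} → u ≢ v → lookup X u ≡ true → lookup X v ≡ true →
  2 ≤ ∣ X ∣
two-members {X = X} {u} {v} u≢v hu hv = subst (_< ∣ X ∣) (∣⁅x⁆∣≡1 u) (p⊂q⇒∣p∣<∣q∣
  ((λ x∈ → subst (_∈ X) (sym (x∈⁅y⁆⇒x≡y u x∈)) (lookup⇒[]= u X hu)) ,
   v , lookup⇒[]= v X hv , λ v∈ → u≢v (sym (x∈⁅y⁆⇒x≡y u v∈))))

module Sparsity {n m : ℕ} (G : Graph n m) (g : Subset n → ℕ)
  (submodular : ∀ A B → 2 ≤ ∣ A ∩ B ∣ → g (A ∩ B) + g (A ∪ B) ≤ g A + g B) where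

  private
    u v : Fin m → Fin n
    u i = proj₁ (ends G i)
    v i = proj₂ (ends G i)

  EdgeSet : Set
  EdgeSet = Fin m → Bool

  induced : Subset n → EdgeSet
  induced X i = lookup X (u i) ∧ lookup X (v i)

  e : EdgeSet → Subset n → ℕ
  e I X = count (λ i → I i ∧ induced X i)

  e-cong : ∀ {I J : EdgeSet} → I ≗ J → ∀ X → e I X ≡ e J X
  e-cong {I} {J} h X = count-cong {f = λ i → I i ∧ induced X i} λ i → cong (_∧ induced X i) (h i)

  e-mono : ∀ {I J : EdgeSet} → (∀ i → I i ≡ true → J i ≡ true) → ∀ X → e I X ≤ e J X
  e-mono {I} {J} h X = count-mono λ i t →
    let t₁ , t₂ = ∧-true {I i} t in cong₂ _∧_ (h i t₁) t₂

  e-classes : ∀ {p} F (c : Fin m → Fin p) X → sum (λ j → e (class F c j) X) ≡ e F X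
  e-classes F c X = trans
    (sum-cong-≗ λ j → count-cong {f = λ i → class F c j i ∧ induced X i} (swap j))
    (count-classes (λ i → F i ∧ induced X i) c)
    where
    swap : ∀ j i → class F c j i ∧ induced X i ≡ class (λ i → F i ∧ induced X i) c j i
    swap j i = trans (∧-assoc (F i) _ (induced X i))
      (trans (cong (F i ∧_) (∧-comm (does (c i ≟ j)) (induced X i)))
             (sym (∧-assoc (F i) (induced X i) (does (c i ≟ j)))))

  e-⊤ : ∀ I → e I ⊤ ≡ count I
  e-⊤ I = count-cong λ i → trans
    (cong (I i ∧_) (cong₂ _∧_ (lookup-replicate (u i) true) (lookup-replicate (v i) true)))
    (∧-identityʳ (I i))

  induced-∩ : ∀ A B i → induced (A ∩ B) i ≡ induced A i ∧ induced B i
  induced-∩ A B i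
    rewrite lookup-zipWith _∧_ (u i) A B | lookup-zipWith _∧_ (v i) A B
    with lookup A (u i) | lookup B (u i)
  ... | false | _     = refl
  ... | true  | false = sym (∧-zeroʳ _)
  ... | true  | true  = refl

  induced-∪ˡ : ∀ A B i → induced A i ≡ true → induced (A ∪ B) i ≡ true
  induced-∪ˡ A B i h
    rewrite lookup-zipWith _∨_ (u i) A B | lookup-zipWith _∨_ (v i) A B
    with lookup A (u i) | lookup A (v i) | h
  ... | true | true | _ = refl

  induced-∪ʳ : ∀ A B i → induced B i ≡ true → induced (A ∪ B) i ≡ true
  induced-∪ʳ A B i h
    rewrite lookup-zipWith _∨_ (u i) A B | lookup-zipWith _∨_ (v i) A B
    with lookup A (u i) | lookup A (v i) | lookup B (u i) | lookup B (v i) | h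
  ... | true  | true  | true | true | _ = refl
  ... | true  | false | true | true | _ = refl
  ... | false | true  | true | true | _ = refl
  ... | false | false | true | true | _ = refl

  -- Looplessness makes the two shared ends distinct.
  common-edge : ∀ A B i → induced A i ≡ true → induced B i ≡ true → 2 ≤ ∣ A ∩ B ∣
  common-edge A B i a b =
    let uv = ∧-true (trans (induced-∩ A B i) (cong₂ _∧_ a b))
    in two-members {X = A ∩ B} (loopless G i) (proj₁ uv) (proj₂ uv)

  Sparse : EdgeSet → Set
  Sparse I = ∀ X → e I X ≤ g X

  Tight : EdgeSet → Subset n → Set
  Tight I X = e I X ≡ g X

  Sparse-cong : ∀ {I J : EdgeSet} → I ≗ J → Sparse I → Sparse J
  Sparse-cong {I} {J} h s X = subst (_≤ g X) (e-cong {I} {J} h X) (s X)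

  -- The violating set is kept because `overfull` later turns it into a tight set.
  sparse? : ∀ I → Sparse I ⊎ ∃ λ X → g X < e I X
  sparse? I with anySubset? (λ X → g X <? e I X)
  ... | yes h = inj₂ h
  ... | no  h = inj₁ λ X → ≮⇒≥ (λ lt → h (X , lt))

  module _ (I : EdgeSet) (sparse : Sparse I) (A B : Subset n)
    (tightA : Tight I A) (tightB : Tight I B) (meet : 2 ≤ ∣ A ∩ B ∣) where

    private
      _[_] : EdgeSet → Subset n → Fin m → ℕ
      (J [ X ]) i = 𝟙 (J i ∧ induced X i)

      crossing : EdgeSet
      crossing i = I i ∧ induced (A ∪ B) i ∧ not (induced A i ∨ induced B i)

      pointwise : ∀ i →
        (I [ A ]) i + (I [ B ]) i + 𝟙 (crossing i) ≡ (I [ A ∩ B ]) i + (I [ A ∪ B ]) i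
      pointwise i
        rewrite lookup-zipWith _∨_ (u i) A B | lookup-zipWith _∨_ (v i) A B
              | lookup-zipWith _∧_ (u i) A B | lookup-zipWith _∧_ (v i) A B
        = uncross-𝟙 (I i) (lookup A (u i)) (lookup A (v i)) (lookup B (u i)) (lookup B (v i))

      total : g A + g B + count crossing ≡ e I (A ∩ B) + e I (A ∪ B)
      total = begin
        g A + g B + count crossing
          ≡⟨ cong₂ (λ x y → x + y + count crossing) tightA tightB ⟨
        e I A + e I B + count crossing
          ≡⟨ cong (_+ count crossing) (∑-distrib-+ (I [ A ]) (I [ B ])) ⟨
        sum (λ i → (I [ A ]) i + (I [ B ]) i) + count crossing
          ≡⟨ ∑-distrib-+ (λ i → (I [ A ]) i + (I [ B ]) i) (𝟙 ∘ crossing) ⟨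
        sum (λ i → (I [ A ]) i + (I [ B ]) i + 𝟙 (crossing i))
          ≡⟨ sum-cong-≗ pointwise ⟩
        sum (λ i → (I [ A ∩ B ]) i + (I [ A ∪ B ]) i)
          ≡⟨ ∑-distrib-+ (I [ A ∩ B ]) (I [ A ∪ B ]) ⟩
        e I (A ∩ B) + e I (A ∪ B) ∎
        where open ≡-Reasoning

      -- By `total` and submodularity the two edge counts add up to at least the sum of their upper
      -- bounds, so both bounds are attained. The same chain leaves no room for a crossing edge.
      squeezed : e I (A ∩ B) ≡ g (A ∩ B) × e I (A ∪ B) ≡ g (A ∪ B)
      squeezed = +-squeeze (sparse _) (sparse _)
        (≤-trans (submodular A B meet) (≤-trans (m≤m+n _ _) (≤-reflexive total)))

      crossing≡0 : count crossing ≡ 0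
      crossing≡0 = n≤0⇒n≡0 (+-cancelˡ-≤ (g A + g B) _ _ (begin
        g A + g B + count crossing ≡⟨ total ⟩
        e I (A ∩ B) + e I (A ∪ B)  ≤⟨ +-mono-≤ (sparse _) (sparse _) ⟩
        g (A ∩ B) + g (A ∪ B)      ≤⟨ submodular A B meet ⟩
        g A + g B                  ≡⟨ +-identityʳ _ ⟨
        g A + g B + 0              ∎))
        where open ≤-Reasoning

    tight-∩ : Tight I (A ∩ B)
    tight-∩ = proj₁ squeezed

    tight-∪ : Tight I (A ∪ B)
    tight-∪ = proj₂ squeezed

    no-crossing : ∀ i → I i ≡ true → induced (A ∪ B) i ≡ true →
      induced A i ≡ true ⊎ induced B i ≡ true
    no-crossing i hI h∪ with induced A i | induced B i | count≡0⇒false crossing crossing≡0 i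
    ... | true  | _     | _ = inj₁ refl
    ... | false | true  | _ = inj₂ refl
    ... | false | false | z rewrite hI | h∪ = contradiction z λ ()

  -- Inserting and exchanging single edges

  e-insert : ∀ {I J a} → I a ≡ false → J a ≡ true → (∀ i → i ≢ a → J i ≡ I i) →
    ∀ X → e J X ≡ e I X + 𝟙 (induced X a)
  e-insert {I} {J} {a} Ia Ja agree X = begin
    e J X                                 ≡⟨ +-identityʳ _ ⟨
    e J X + 0                             ≡⟨ cong (λ b → e J X + 𝟙 (b ∧ induced X a)) Ia ⟨
    e J X + 𝟙 (I a ∧ induced X a)
      ≡⟨ sum-update _ (λ i → 𝟙 (I i ∧ induced X i)) a (λ i i≢a → cong (λ b → 𝟙 (b ∧ induced X i)) (agree i i≢a)) ⟩
    e I X + 𝟙 (J a ∧ induced X a)         ≡⟨ cong (λ b → e I X + 𝟙 (b ∧ induced X a)) Ja ⟩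
    e I X + 𝟙 (induced X a)               ∎
    where open ≡-Reasoning

  -- I and J have a common part K with I = K + b and J = K + a.
  record Exchange (I J : EdgeSet) (a b : Fin m) : Set where
    field
      a≢b   : a ≢ b
      a∉I   : I a ≡ false
      b∈I   : I b ≡ true
      a∈J   : J a ≡ true
      b∉J   : J b ≡ false
      agree : ∀ i → i ≢ a → i ≢ b → I i ≡ J i

    -- Both sides count `K + a + b` inside `X`.
    e-exchange : ∀ X → e I X + 𝟙 (induced X a) ≡ e J X + 𝟙 (induced X b)
    e-exchange X = begin
      e I X + 𝟙 (induced X a)                     ≡⟨ cong (_+ 𝟙 (induced X a)) (e-insert (remove-self I b) b∈I (λ i i≢b → sym (remove-other I i≢b)) X) ⟩
      e K X + 𝟙 (induced X b) + 𝟙 (induced X a)   ≡⟨ +-assoc (e K X) _ _ ⟩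
      e K X + (𝟙 (induced X b) + 𝟙 (induced X a)) ≡⟨ cong (e K X +_) (+-comm (𝟙 (induced X b)) _) ⟩
      e K X + (𝟙 (induced X a) + 𝟙 (induced X b)) ≡⟨ +-assoc (e K X) _ _ ⟨
      e K X + 𝟙 (induced X a) + 𝟙 (induced X b)   ≡⟨ cong (_+ 𝟙 (induced X b)) (e-insert (trans (remove-other I a≢b) a∉I) a∈J J≗K X) ⟨
      e J X + 𝟙 (induced X b)                     ∎
      where
      open ≡-Reasoning
      K = remove I b
      J≗K : ∀ i → i ≢ a → J i ≡ K i
      J≗K i i≢a with i ≟ b
      ... | yes refl = trans b∉J (sym (∧-zeroʳ (I i)))
      ... | no  i≢b  = trans (sym (agree i i≢a i≢b)) (sym (∧-identityʳ (I i)))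

    -- If `X` contained `b` but not `a`, then `e I X` would be `e J X + 1 = g X + 1`, too much for a
    -- sparse `I`.
    tight-contains : Sparse I → ∀ {X} → Tight J X → induced X b ≡ true → induced X a ≡ true
    tight-contains sparse {X} tight b∈X with induced X a | e-exchange X
    ... | true  | _ = refl
    ... | false | h rewrite b∈X | tight | +-identityʳ (e I X) | +-comm (g X) 1 =
      contradiction (sparse X) (<⇒≱ (≤-reflexive (sym h)))

    tight-exchange : ∀ {X} → Tight J X → induced X a ≡ induced X b → Tight I X
    tight-exchange {X} tight h = trans
      (+-cancelʳ-≡ (𝟙 (induced X b)) _ _
        (trans (cong (λ x → e I X + 𝟙 x) (sym h)) (e-exchange X)))
      tight

  -- In use, `b` tells whether a newly added edge lies in `X`: a violation of sparsity caused by
  -- adding it exhibits a tight set around it.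
  overfull : ∀ I → Sparse I → ∀ X b → g X < e I X + 𝟙 b → b ≡ true × Tight I X
  overfull I s X false h = contradiction (≤-trans h (≤-reflexive (+-identityʳ _))) (≤⇒≯ (s X))
  overfull I s X true  h = refl ,
    ≤-antisym (s X) (≤-pred (≤-trans h (≤-reflexive (+-comm (e I X) 1))))

  -- Bounding a set of edges covered by tight sets

  module _ {p : ℕ} {F I r : EdgeSet} (F-sparse : ∀ X → e F X ≤ p * g X)
    (r⊆F : ∀ i → r i ≡ true → F i ≡ true) (I-sparse : Sparse I) where

    Closed : Subset n → Set
    Closed Y = Tight I Y × (∀ i → I i ≡ true → induced Y i ≡ true → r i ≡ true)

    Cover : ∀ {k} → (Fin k → Subset n) → Set
    Cover Ys = ∀ i → r i ≡ true → ∃ λ a → induced (Ys a) i ≡ true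

    -- Each edge of `r` is charged to a set covering it, and `e r Y ≤ p * g Y = p * e I Y` for a
    -- closed `Y`. An edge of `I` lies in at most one of the sets, since two would share both its
    -- ends, and closedness then puts it in `r`.
    apart-bound : ∀ {k} (Ys : Fin k → Subset n) → (∀ a → Closed (Ys a)) → Cover Ys →
      (∀ a b → a ≢ b → ¬ (2 ≤ ∣ Ys a ∩ Ys b ∣)) → count r ≤ p * count (λ i → r i ∧ I i)
    apart-bound Ys closed cover apart = begin
      count r
        ≤⟨ sum-mono covered ⟩
      sum (λ i → count (λ a → r i ∧ induced (Ys a) i))
        ≡⟨ ∑-comm (λ i a → 𝟙 (r i ∧ induced (Ys a) i)) ⟩
      sum (λ a → e r (Ys a))
        ≤⟨ sum-mono (λ a → ≤-trans (e-mono r⊆F (Ys a)) (F-sparse (Ys a))) ⟩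
      sum (λ a → p * g (Ys a))
        ≡⟨ sum-cong-≗ (λ a → cong (p *_) (proj₁ (closed a))) ⟨
      sum (λ a → p * e I (Ys a))
        ≡⟨ *-distribˡ-sum p (λ a → e I (Ys a)) ⟨
      p * sum (λ a → e I (Ys a))
        ≡⟨ cong (p *_) (∑-comm (λ a i → 𝟙 (I i ∧ induced (Ys a) i))) ⟩
      p * sum (λ i → count (λ a → I i ∧ induced (Ys a) i))
        ≤⟨ *-monoʳ-≤ p (sum-mono disjoint) ⟩
      p * count (λ i → r i ∧ I i) ∎
      where
      open ≤-Reasoning
      covered : ∀ i → 𝟙 (r i) ≤ count (λ a → r i ∧ induced (Ys a) i)
      covered i with r i | cover i
      ... | false | _ = z≤n
      ... | true  | c = let a , h = c refl in
        ≤-trans (≤-reflexive (cong 𝟙 (sym h))) (term≤sum (λ a → 𝟙 (induced (Ys a) i)) a)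
      disjoint : ∀ i → count (λ a → I i ∧ induced (Ys a) i) ≤ 𝟙 (r i ∧ I i)
      disjoint i = count-disjoint _ _
        (λ a t → let t₁ , t₂ = ∧-true {I i} t in cong₂ _∧_ (proj₂ (closed a) i t₁ t₂) t₁)
        (λ a b a≢b s t → apart a b a≢b
          (common-edge (Ys a) (Ys b) i (proj₂ (∧-true {I i} s)) (proj₂ (∧-true {I i} t))))

    -- By `no-crossing`, an edge of `I` inside the union is already inside `A` or inside `B`.
    closed-∪ : ∀ {A B} → Closed A → Closed B → 2 ≤ ∣ A ∩ B ∣ → Closed (A ∪ B)
    closed-∪ {A} {B} (tA , cA) (tB , cB) meet =
      tight-∪ I I-sparse A B tA tB meet , λ i hI h → case (no-crossing I I-sparse A B tA tB meet i hI h) hI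
      where
      case : ∀ {i} → induced A i ≡ true ⊎ induced B i ≡ true → I i ≡ true → r i ≡ true
      case (inj₁ h) hI = cA _ hI h
      case (inj₂ h) hI = cB _ hI h

    -- Induction on the number of sets: two that share at least two vertices are merged, until
    -- `apart-bound` applies.
    cover-bound : ∀ {k} (Ys : Fin k → Subset n) → (∀ a → Closed (Ys a)) → Cover Ys →
      count r ≤ p * count (λ i → r i ∧ I i)
    cover-bound {zero}  Ys closed cover = apart-bound Ys closed cover λ ()
    cover-bound {suc k} Ys closed cover
      with any? (λ a → any? (λ b → ¬? (a ≟ b) ×-dec (2 ≤? ∣ Ys a ∩ Ys b ∣)))
    ... | no  none = apart-bound Ys closed cover λ a b a≢b h → none (a , b , a≢b , h)
    -- The union is stored at index `a`, and `punchIn b` skips index `b`, so the family loses one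
    -- member.
    ... | yes (a , b , a≢b , meet) = cover-bound (Zs ∘ punchIn b) (closedZ ∘ punchIn b) coverZ
      where
      Zs : Fin (suc k) → Subset n
      Zs = updateAt Ys a (_∪ Ys b)

      Zs-a : Zs a ≡ Ys a ∪ Ys b
      Zs-a = updateAt-updates a Ys

      closedZ : ∀ c → Closed (Zs c)
      closedZ c with c ≟ a
      ... | yes refl = subst Closed (sym Zs-a) (closed-∪ (closed a) (closed b) meet)
      ... | no  c≢a  = subst Closed (sym (updateAt-minimal c a Ys c≢a)) (closed c)

      reindex : ∀ i c → c ≢ b → induced (Zs c) i ≡ true →
        ∃ λ d → induced (Zs (punchIn b d)) i ≡ true
      reindex i c c≢b h = punchOut (c≢b ∘ sym) ,
        subst (λ d → induced (Zs d) i ≡ true) (sym (punchIn-punchOut (c≢b ∘ sym))) h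

      coverZ : Cover (Zs ∘ punchIn b)
      coverZ i ri with cover i ri
      ... | c , h with c ≟ a | c ≟ b
      ... | yes refl | _ = reindex i a a≢b
        (subst (λ Y → induced Y i ≡ true) (sym Zs-a) (induced-∪ˡ (Ys a) (Ys b) i h))
      ... | no _ | yes refl = reindex i a a≢b
        (subst (λ Y → induced Y i ≡ true) (sym Zs-a) (induced-∪ʳ (Ys a) (Ys b) i h))
      ... | no c≢a | no c≢b = reindex i c c≢b
        (subst (λ Y → induced Y i ≡ true) (sym (updateAt-minimal c a Ys c≢a)) h)

  common-subset : ∀ {k} {P : Subset n → Set} → (∀ {A B} → P A → P B → P (A ∩ B)) → ∃ P →
    (Xs : Fin k → Subset n) → (∀ a → P (Xs a)) →
    ∃ λ T → P T × (∀ a i → induced T i ≡ true → induced (Xs a) i ≡ true)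
  common-subset {zero}  P-∩ (X , PX) Xs PXs = X , PX , λ ()
  common-subset {suc k} P-∩ P-some Xs PXs
    with common-subset P-∩ P-some (Xs ∘ suc) (PXs ∘ suc)
  ... | T , PT , sub = Xs zero ∩ T , P-∩ (PXs zero) PT , λ
    { zero    i h → proj₁ (split i h)
    ; (suc a) i h → sub a i (proj₂ (split i h)) }
    where
    split : ∀ i → induced (Xs zero ∩ T) i ≡ true → induced (Xs zero) i ≡ true × induced T i ≡ true
    split i h = ∧-true (trans (sym (induced-∩ (Xs zero) T i)) h)

  -- Augmenting a partial colouring

  Colouring : ∀ {p} → EdgeSet → (Fin m → Fin p) → Set
  Colouring F c = ∀ j → Sparse (class F c j)

  module Augment {p : ℕ} (F : EdgeSet) (F-sparse : ∀ X → e F X ≤ p * g X)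
    (uncolourable : ¬ ∃ (Colouring {p} F)) where

    -- A colouring with its missing edge. The colouring is a total function, but `cls` masks the
    -- missing edge and all edges outside `F`, so its values there are arbitrary.
    Config : Set
    Config = (Fin m → Fin p) × Fin m

    cls : Config → Fin p → EdgeSet
    cls (c , a) = class (remove F a) c

    Valid : Config → Set
    Valid (c , a) = F a ≡ true × (∀ j → Sparse (cls (c , a) j))

    -- The coloured edge b becomes uncoloured and hands its colour to a.
    Step : Config → Config → Set
    Step (c , a) (c′ , b) = a ≢ b × c′ a ≡ c b × (∀ i → i ≢ a → i ≢ b → c i ≡ c′ i)

    module _ {c c′ : Fin m → Fin p} {a b : Fin m} (step : Step (c , a) (c′ , b))
      (Fa : F a ≡ true) (Fb : F b ≡ true) where

      private
        a≢b    = proj₁ step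
        c′a≡cb = proj₁ (proj₂ step)
        same   = proj₂ (proj₂ step)

        agree : ∀ j i → i ≢ a → i ≢ b → cls (c , a) j i ≡ cls (c′ , b) j i
        agree j i i≢a i≢b = class-cong {f = remove F a} {remove F b} {c} {c′}
          (trans (remove-other F i≢a) (sym (remove-other F i≢b))) (same i i≢a i≢b) j

      -- The edge `b` leaves colour `c b` and `a` joins that same colour; no other class is touched.
      step-other : ∀ j → j ≢ c b → cls (c , a) j ≗ cls (c′ , b) j
      step-other j j≢ i = by-cases (i ≟ a) (i ≟ b)
        where
        by-cases : Dec (i ≡ a) → Dec (i ≡ b) → cls (c , a) j i ≡ cls (c′ , b) j i
        by-cases (yes refl) _ = trans (class-false (remove F a) c (remove-self F a))
          (sym (class-other (remove F b) c′ (λ h → j≢ (trans (sym h) c′a≡cb))))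
        by-cases (no _) (yes refl) = trans (class-other (remove F a) c (j≢ ∘ sym))
          (sym (class-false (remove F b) c′ (remove-self F b)))
        by-cases (no i≢a) (no i≢b) = agree j i i≢a i≢b

      step-exchange : Exchange (cls (c , a) (c b)) (cls (c′ , b) (c b)) a b
      step-exchange = record
        { a≢b   = a≢b
        ; a∉I   = class-false (remove F a) c (remove-self F a)
        ; b∈I   = trans (class-same (remove F a) c refl) (trans (remove-other F (a≢b ∘ sym)) Fb)
        ; a∈J   = trans (class-same (remove F b) c′ c′a≡cb) (trans (remove-other F a≢b) Fa)
        ; b∉J   = class-false (remove F b) c′ (remove-self F b)
        ; agree = agree (c b)
        }

    ValidStep : Config → Config → Set
    ValidStep x y = Valid x × Valid y × Step x y

    module Reach (x₀ : Config) (valid₀ : Valid x₀) where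

      Reachable : Config → Set
      Reachable = Star ValidStep x₀

      R : Fin m → Set
      R i = ∃ λ c → Reachable (c , i)

      reachable-valid : ∀ {x y} → Valid x → Star ValidStep x y → Valid y
      reachable-valid v ε = v
      reachable-valid v ((_ , v′ , _) ◅ path) = reachable-valid v′ path

      R⊆F : ∀ {i} → R i → F i ≡ true
      R⊆F (c , path) = proj₁ (reachable-valid valid₀ path)

      -- `Closed` with the proposition `R` in place of a Boolean edge set, as `R` is not known to be
      -- decidable here.
      Confined : Config → Fin p → Fin m → Set
      Confined x j i = ∃ λ Y → Tight (cls x j) Y × induced Y i ≡ true ×
        (∀ f → cls x j f ≡ true → induced Y f ≡ true → R f)

      -- Colouring `a` with `j` must fail, which yields a tight set around `a` (`blocked`). For each
      -- `f` of colour `j`, either exchanging `a` for `f` is a valid step and `f` is in `R`, or its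
      -- failure yields a tight set containing `a` but not `f`. All these sets contain both ends of
      -- `a`, so their intersection is tight, and the edges of colour `j` left in it are in `R`.
      saturated : ∀ {c a} → Reachable (c , a) → ∀ j → Confined (c , a) j a
      saturated {c} {a} path j = let T , (tight , a∈T) , sub = meet in
        T , tight , a∈T , λ f hf f∈T → proj₂ (proj₂ (candidate f)) hf (sub f f f∈T)
        where
        valid = reachable-valid valid₀ path
        Fa = proj₁ valid
        I = cls (c , a) j
        I-sparse = proj₂ valid j

        -- One colouring serves twice: as the attempted completion of `c` and, with `f` missing, as
        -- the target of a step.
        c′ : Fin m → Fin p
        c′ = updateAt c a (const j)

        c′a : c′ a ≡ j
        c′a = updateAt-updates a c

        c′-other : ∀ i → i ≢ a → c i ≡ c′ i
        c′-other i i≢a = sym (updateAt-minimal i a c i≢a)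

        P : Subset n → Set
        P X = Tight I X × induced X a ≡ true

        P-∩ : ∀ {A B} → P A → P B → P (A ∩ B)
        P-∩ {A} {B} (tA , aA) (tB , aB) =
          tight-∩ I I-sparse A B tA tB (common-edge A B a aA aB) ,
          trans (induced-∩ A B a) (cong₂ _∧_ aA aB)

        old : ∀ k i → i ≢ a → class F c′ k i ≡ cls (c , a) k i
        old k i i≢a = sym (class-cong {f = remove F a} {F} {c} {c′}
          (remove-other F i≢a) (c′-other i i≢a) k)

        blocked : ∃ P
        blocked with sparse? (class F c′ j)
        ... | inj₂ (X , lt) =
          let a∈X , tight = overfull I I-sparse X (induced X a) (subst (g X <_)
                (e-insert {I} {class F c′ j} (class-false (remove F a) c (remove-self F a))
                  (trans (class-same F c′ c′a) Fa) (old j) X) lt)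
          in X , tight , a∈X
        ... | inj₁ s = ⊥-elim (uncolourable (c′ , colouring))
          where
          colouring : Colouring F c′
          colouring k with k ≟ j
          ... | yes refl = s
          ... | no  k≢j  = Sparse-cong {cls (c , a) k} same (proj₂ valid k)
            where
            same : cls (c , a) k ≗ class F c′ k
            same i = by-cases (i ≟ a)
              where
              by-cases : Dec (i ≡ a) → cls (c , a) k i ≡ class F c′ k i
              by-cases (no i≢a)   = sym (old k i i≢a)
              by-cases (yes refl) = trans (class-false (remove F a) c (remove-self F a))
                (sym (class-other F c′ (λ h → k≢j (trans (sym h) c′a))))

        candidate : ∀ f → ∃ λ X → P X × (I f ≡ true → induced X f ≡ true → R f)
        candidate f with I f in eq
        ... | false = let X , PX = blocked in X , PX , λ ()
        ... | true  = test (sparse? (cls (c′ , f) j))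
          where
          f∈ = class-true (remove F a) c eq
          cf≡j = proj₂ f∈
          Ff = proj₁ (remove-true F (proj₁ f∈))
          f≢a = proj₂ (remove-true F (proj₁ f∈))

          step : Step (c , a) (c′ , f)
          step = (f≢a ∘ sym) , trans c′a (sym cf≡j) , λ i i≢a _ → c′-other i i≢a

          exchange : Exchange I (cls (c′ , f) j) a f
          exchange = subst (λ k → Exchange (cls (c , a) k) (cls (c′ , f) k) a f) cf≡j
            (step-exchange step Fa Ff)

          valid′ : Sparse (cls (c′ , f) j) → Valid (c′ , f)
          valid′ s = Ff , sparse′
            where
            sparse′ : ∀ k → Sparse (cls (c′ , f) k)
            sparse′ k with k ≟ j
            ... | yes refl = s
            ... | no  k≢j  = Sparse-cong (step-other step Fa Ff k (λ h → k≢j (trans h cf≡j))) (proj₂ valid k)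

          test : Sparse (cls (c′ , f) j) ⊎ (∃ λ X → g X < e (cls (c′ , f) j) X) →
            ∃ λ X → P X × (true ≡ true → induced X f ≡ true → R f)
          test (inj₁ s) = let X , PX = blocked in
            X , PX , λ _ _ → c′ , path ◅◅ ((valid , valid′ s , step) ◅ ε)
          test (inj₂ (X , lt)) with induced X f in f∈X | Exchange.e-exchange exchange X
          -- As `X` avoids `f`, adding `a` to `I` without removing `f` violates the bound at `X`
          -- too.
          ... | false | h =
            let a∈X , tight = overfull I I-sparse X (induced X a)
                  (<-≤-trans lt (≤-reflexive (trans (sym (+-identityʳ _)) (sym h))))
            in X , (tight , a∈X) , λ _ t → contradiction f∈X (true≢false t)
          -- If `X` contains `f`, the exchange cannot increase the number of edges inside `X`, so
          -- there is no violation.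
          ... | true  | h = contradiction (begin-strict
            g X + 1                  <⟨ +-monoˡ-< 1 lt ⟩
            e (cls (c′ , f) j) X + 1 ≡⟨ h ⟨
            e I X + 𝟙 (induced X a)  ≤⟨ +-mono-≤ (I-sparse X) (𝟙≤1 (induced X a)) ⟩
            g X + 1                  ∎) (<-irrefl refl)
            where open ≤-Reasoning

        meet = common-subset P-∩ blocked (proj₁ ∘ candidate) (proj₁ ∘ proj₂ ∘ candidate)

      -- Steps are followed backwards: `saturated` confines an edge in the configuration missing it,
      -- at the end of a path, while the count takes place at its start. Only the class of colour
      -- `c b` changes, from `J` back to `I`.
      confined-back : ∀ {x y} → ValidStep x y → Reachable y → ∀ {j i} →
        Confined y j i → Confined x j i
      confined-back {c , a} {c′ , b} (valid , (Fb , _) , step) path {j} {i} (Y , tight , i∈Y , Y⊆R) =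
        by-cases (j ≟ c b)
        where
        I = cls (c , a) (c b)
        J = cls (c′ , b) (c b)

        Fa = proj₁ valid
        I-sparse = proj₂ valid (c b)
        J-sparse = proj₂ (reachable-valid valid₀ path) (c b)
        open Exchange (step-exchange step Fa Fb)

        -- The edge `b` is in `R` because the reachable configuration after the step misses it.
        I⊆J+b : ∀ f → I f ≡ true → R f ⊎ J f ≡ true
        I⊆J+b f hf = by-cases (f ≟ b)
          where
          by-cases : Dec (f ≡ b) → R f ⊎ J f ≡ true
          by-cases (yes refl) = inj₁ (c′ , path)
          by-cases (no f≢b)   = inj₂ (trans (sym (agree f (λ { refl → true≢false hf a∉I }) f≢b)) hf)

        -- If Y contains a but not b it stops being tight for I, but its union
        -- with a confining set of b contains both.
        enlarged : induced Y a ≡ true → Tight J Y → (∀ f → J f ≡ true → induced Y f ≡ true → R f) →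
          Confined (c , a) (c b) i
        enlarged a∈Y tightY Y⊆R =
          let T , tightT , b∈T , T⊆R = saturated path (c b)
              a∈T  = tight-contains I-sparse tightT b∈T
              meet = common-edge Y T a a∈Y a∈T
              confined : ∀ f → I f ≡ true → induced (Y ∪ T) f ≡ true → R f
              confined f hf f∈ = [ (λ Rf → Rf) , (λ hJ →
                [ Y⊆R f hJ , T⊆R f hJ ] (no-crossing J J-sparse Y T tightY tightT meet f hJ f∈)) ] (I⊆J+b f hf)
          in Y ∪ T ,
             tight-exchange (tight-∪ J J-sparse Y T tightY tightT meet)
               (trans (induced-∪ˡ Y T a a∈Y) (sym (induced-∪ʳ Y T b b∈T))) ,
             induced-∪ˡ Y T i i∈Y ,
             confined

        by-cases : Dec (j ≡ c b) → Confined (c , a) j i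
        by-cases (no j≢) = Y , trans (e-cong same Y) tight , i∈Y ,
          λ f hf → Y⊆R f (trans (sym (same f)) hf)
          where same = step-other step Fa Fb j j≢
        by-cases (yes refl) with induced Y a in a∈?Y
        ... | true  = enlarged a∈?Y tight Y⊆R
        -- By `tight-contains`, avoiding `a` entails avoiding `b`, so `Y` itself remains tight for
        -- `I`.
        ... | false = Y , tight-exchange tight (trans a∈?Y (sym b∉Y)) , i∈Y ,
          λ f hf f∈ → [ (λ Rf → Rf) , (λ hJ → Y⊆R f hJ f∈) ] (I⊆J+b f hf)
          where
          b∉Y : induced Y b ≡ false
          b∉Y = ¬-not λ b∈Y → true≢false (tight-contains I-sparse tight b∈Y) a∈?Y

      confined-back* : ∀ {x y} → Reachable x → Star ValidStep x y → ∀ {j i} →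
        Confined y j i → Confined x j i
      confined-back* path ε         conf = conf
      confined-back* path (s ◅ rest) conf =
        confined-back s path′ (confined-back* path′ rest conf)
        where path′ = path ◅◅ (s ◅ ε)

      -- Brings the confining sets of all edges of `R` to the single configuration `x₀`, whose
      -- classes can then be counted together.
      R-confined : ∀ {i} → R i → ∀ j → Confined x₀ j i
      R-confined (c , path) j = confined-back* ε path (saturated path j)

      -- Once `R` is a Boolean set `r`, `cover-bound` applies to every colour. The contradiction
      -- comes from `a₀`, which is in `r` but in no class of `x₀`, so the classes contain only
      -- `count r - 1` edges of `r`.
      R-undecidable : ¬ (∀ i → Dec (R i))
      R-undecidable R? = 1+n≰n (*-cancelˡ-≤ p (begin
        p * suc (count (remove r a₀))       ≡⟨ cong (p *_) (count-remove r a₀ (dec-true (R? a₀) R-a₀)) ⟨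
        p * count r                         ≡⟨ sum-const p (count r) ⟨
        sum {p} (λ _ → count r)             ≤⟨ sum-mono bound ⟩
        sum (λ j → p * count (class (remove r a₀) c₀ j)) ≡⟨ *-distribˡ-sum p (λ j → count (class (remove r a₀) c₀ j)) ⟨
        p * sum (λ j → count (class (remove r a₀) c₀ j)) ≡⟨ cong (p *_) (count-classes (remove r a₀) c₀) ⟩
        p * count (remove r a₀)             ∎))
        where
        open ≤-Reasoning
        c₀ = proj₁ x₀
        a₀ = proj₂ x₀

        instance
          -- The colour `c₀ a₀` shows that there is a colour, which allows cancelling `p`.
          p≢0 : NonZero p
          p≢0 = nonZeroIndex (c₀ a₀)

        R-a₀ : R a₀
        R-a₀ = c₀ , ε

        r : EdgeSet
        r i = does (R? i)

        r⇒R : ∀ {i} → r i ≡ true → R i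
        r⇒R {i} h with R? i
        ... | yes Ri = Ri

        restrict : ∀ j i → r i ∧ cls x₀ j i ≡ class (remove r a₀) c₀ j i
        restrict j i with R? i
        ... | no  _  = refl
        ... | yes Ri rewrite R⊆F Ri = refl

        bound : ∀ j → count r ≤ p * count (class (remove r a₀) c₀ j)
        bound j = ≤-trans
          (cover-bound {p} {F} {cls x₀ j} {r} F-sparse (λ i → R⊆F ∘ r⇒R) (proj₂ valid₀ j) (proj₁ ∘ Y) (proj₁ ∘ proj₂ ∘ Y)
            (λ i h → i , proj₂ (proj₂ (Y i)) h))
          (≤-reflexive (cong (p *_) (count-cong (restrict j))))
          where
          Y : ∀ i → ∃ λ Y → (Tight (cls x₀ j) Y × (∀ f → cls x₀ j f ≡ true → induced Y f ≡ true → r f ≡ true))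
            × (r i ≡ true → induced Y i ≡ true)
          Y i with R? i
          ... | yes Ri = let Y , tight , i∈Y , Y⊆R = R-confined Ri j in
            Y , (tight , λ f hf f∈ → dec-true (R? f) (Y⊆R f hf f∈)) , λ _ → i∈Y
          -- The family is indexed by all edges; outside `r` it is padded with the closed set of
          -- `a₀`.
          ... | no  _  = let Y , tight , _ , Y⊆R = R-confined R-a₀ j in
            Y , (tight , λ f hf f∈ → dec-true (R? f) (Y⊆R f hf f∈)) , λ ()

    -- `sequence` moves double negation past the finite quantifier, so all instances of excluded
    -- middle for `R` are available at once.
    no-valid : ∀ x → ¬ Valid x
    no-valid x valid = sequence (RawMonad.rawApplicative ¬¬-Monad) (λ _ → ¬¬-excluded-middle)
      (Reach.R-undecidable x valid)

  -- Exhaustive search over colourings coded as elements of a finite type. Decoding recovers a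
  -- function only pointwise, hence `Sparse-cong`.
  colouring? : ∀ {p} F → Dec (∃ (Colouring {p} F))
  colouring? {p} F = map′
    (λ (k , h) → finToFun k , h)
    (λ (c , h) → funToFin c , λ j → Sparse-cong (λ i → cong (λ x → F i ∧ does (x ≟ j)) (sym (finToFun-funToFin c i))) (h j))
    (any? λ k → all? λ j → decide (class F (finToFun k) j))
    where
    decide : ∀ I → Dec (Sparse I)
    decide I with sparse? I
    ... | inj₁ s        = yes s
    ... | inj₂ (X , lt) = no λ s → <⇒≱ lt (s X)

  -- Matroid union for p copies of the sparsity matroid.
  colourable : ∀ {p} → Fin p → ∀ F → (∀ X → e F X ≤ p * g X) → ∃ (Colouring {p} F)
  colourable {p} j₀ F F-sparse = by-size (count F) F ≤-refl F-sparse
    where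
    by-size : ∀ s F → count F ≤ s → (∀ X → e F X ≤ p * g X) → ∃ (Colouring {p} F)
    by-size s F size F-sparse with any? (λ a → F a Bool.≟ true)
    -- Without edges in `F` any colouring works; `j₀` supplies its values.
    ... | no none = const j₀ , λ j X → ≤-trans (≤-reflexive (count-false λ i →
      cong (λ b → (b ∧ _) ∧ induced X i) (¬-not λ Fi → none (i , Fi)))) z≤n
    by-size zero F size F-sparse | yes (a , Fa) = contradiction (subst (_≤ 0) (count-remove F a Fa) size) λ ()
    by-size (suc s) F size F-sparse | yes (a , Fa) =
      let c , colouring = by-size s (remove F a) (≤-pred (subst (_≤ suc s) (count-remove F a Fa) size))
            (λ X → ≤-trans (e-mono (λ i h → proj₁ (remove-true F h)) X) (F-sparse X))
      -- The colouring of `F` without `a` is a valid configuration missing `a`, which an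
      -- uncolourable `F` excludes.
      in decidable-stable (colouring? F) λ uncolourable →
           Augment.no-valid F F-sparse uncolourable (c , a) (Fa , colouring)

-- Rigidity in terms of sparsity

open import Data.Integer using (+_)

sumFin-cong : ∀ {k} {f g : Fin k → ℤ} → f ≗ g → sumFin f ≡ sumFin g
sumFin-cong {zero}  h = refl
sumFin-cong {suc k} h = cong₂ ℤ._+_ (h zero) (sumFin-cong (h ∘ suc))

sumFin-+ : ∀ {k} (f g : Fin k → ℤ) → sumFin (λ i → f i ℤ.+ g i) ≡ sumFin f ℤ.+ sumFin g
sumFin-+ {zero}  f g = refl
sumFin-+ {suc k} f g = trans (cong (λ x → f zero ℤ.+ g zero ℤ.+ x) (sumFin-+ (f ∘ suc) (g ∘ suc)))
  (shuffle (f zero) (g zero) _ _)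
  where
  shuffle : ∀ a b c d → a ℤ.+ b ℤ.+ (c ℤ.+ d) ≡ a ℤ.+ c ℤ.+ (b ℤ.+ d)
  shuffle = solve-∀

sumFin-* : ∀ {k} x (f : Fin k → ℤ) → sumFin (λ i → x ℤ.* f i) ≡ x ℤ.* sumFin f
sumFin-* {zero}  x f = sym (ℤ.*-zeroʳ x)
sumFin-* {suc k} x f = trans (cong (λ y → x ℤ.* f zero ℤ.+ y) (sumFin-* x (f ∘ suc)))
  (sym (ℤ.*-distribˡ-+ x (f zero) _))

sumFin-𝟙 : ∀ {k} (b : Fin k → Bool) → sumFin (λ i → if b i then + 1 else + 0) ≡ + count b
sumFin-𝟙 {zero}  b = refl
sumFin-𝟙 {suc k} b = cong₂ ℤ._+_ (sym (if-float +_ (b zero))) (sumFin-𝟙 (b ∘ suc))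

module _ {n : ℕ} (ℓ : SetFun n) where

  sumOver-modular : ∀ A B →
    sumOver ℓ (A ∩ B) ℤ.+ sumOver ℓ (A ∪ B) ≡ sumOver ℓ A ℤ.+ sumOver ℓ B
  sumOver-modular A B = trans (sym (sumFin-+ (term (A ∩ B)) (term (A ∪ B))))
    (trans (sumFin-cong pointwise) (sumFin-+ (term A) (term B)))
    where
    term : Subset n → Fin n → ℤ
    term X v = if lookup X v then pt ℓ v else + 0
    pointwise : ∀ v → term (A ∩ B) v ℤ.+ term (A ∪ B) v ≡ term A v ℤ.+ term B v
    pointwise v
      rewrite lookup-zipWith _∧_ v A B | lookup-zipWith _∨_ v A B
      with lookup A v | lookup B v
    ... | true  | true  = refl
    ... | true  | false = ℤ.+-comm (+ 0) (pt ℓ v)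
    ... | false | true  = refl
    ... | false | false = refl

  sumOver-scale : ∀ p X → sumOver (scale p ℓ) X ≡ + p ℤ.* sumOver ℓ X
  sumOver-scale p X = trans (sumFin-cong pointwise) (sumFin-* (+ p) (λ v → if lookup X v then pt ℓ v else + 0))
    where
    pointwise : ∀ v → (if lookup X v then + p ℤ.* pt ℓ v else + 0)
      ≡ + p ℤ.* (if lookup X v then pt ℓ v else + 0)
    pointwise v with lookup X v
    ... | true  = refl
    ... | false = sym (ℤ.*-zeroʳ (+ p))

  -- The function `g` with natural values. Weak subadditivity makes the difference nonnegative, so
  -- the absolute value changes nothing (`deficit-correct`).
  deficit : Subset n → ℕ
  deficit X = ℤ.∣ sumOver ℓ X ℤ.- ℓ X ∣

  module _ (subadditive : WeaklySubadditive ℓ) where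

    deficit-correct : ∀ X → sumOver ℓ X ℤ.- ℓ X ≡ + deficit X
    deficit-correct X = sym (ℤ.0≤i⇒+∣i∣≡i (ℤ.i≤j⇒0≤j-i (subadditive X)))

    deficit-scale : ∀ p X → sumOver (scale p ℓ) X ℤ.- scale p ℓ X ≡ + (p * deficit X)
    deficit-scale p X = begin
      sumOver (scale p ℓ) X ℤ.- + p ℤ.* ℓ X ≡⟨ cong (ℤ._- + p ℤ.* ℓ X) (sumOver-scale p X) ⟩
      + p ℤ.* sumOver ℓ X ℤ.- + p ℤ.* ℓ X   ≡⟨ factor (+ p) (sumOver ℓ X) (ℓ X) ⟩
      + p ℤ.* (sumOver ℓ X ℤ.- ℓ X)         ≡⟨ cong (+ p ℤ.*_) (deficit-correct X) ⟩
      + p ℤ.* + deficit X                   ≡⟨ ℤ.pos-* p (deficit X) ⟨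
      + (p * deficit X)                     ∎
      where
      open ≡-Reasoning
      factor : ∀ q a b → q ℤ.* a ℤ.- q ℤ.* b ≡ q ℤ.* (a ℤ.- b)
      factor = solve-∀

    -- `sumOver ℓ` is modular, so subtracting `ℓ` turns supermodularity into submodularity for the
    -- same pairs of sets.
    deficit-submodular : TwoIntersectingSupermodular ℓ → ∀ A B → 2 ≤ ∣ A ∩ B ∣ →
      deficit (A ∩ B) + deficit (A ∪ B) ≤ deficit A + deficit B
    deficit-submodular supermodular A B meet = ℤ.drop‿+≤+ (begin
      + deficit (A ∩ B) ℤ.+ + deficit (A ∪ B)
        ≡⟨ combine (A ∩ B) (A ∪ B) ⟩
      sumOver ℓ (A ∩ B) ℤ.+ sumOver ℓ (A ∪ B) ℤ.- (ℓ (A ∩ B) ℤ.+ ℓ (A ∪ B))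
        ≡⟨ cong (ℤ._- (ℓ (A ∩ B) ℤ.+ ℓ (A ∪ B))) (sumOver-modular A B) ⟩
      sumOver ℓ A ℤ.+ sumOver ℓ B ℤ.- (ℓ (A ∩ B) ℤ.+ ℓ (A ∪ B))
        ≤⟨ ℤ.+-monoʳ-≤ (sumOver ℓ A ℤ.+ sumOver ℓ B) (ℤ.neg-mono-≤ (supermodular A B meet)) ⟩
      sumOver ℓ A ℤ.+ sumOver ℓ B ℤ.- (ℓ A ℤ.+ ℓ B)
        ≡⟨ combine A B ⟨
      + deficit A ℤ.+ + deficit B ∎)
      where
      open ℤ.≤-Reasoning
      shuffle : ∀ a b c d → a ℤ.- b ℤ.+ (c ℤ.- d) ≡ a ℤ.+ c ℤ.- (b ℤ.+ d)
      shuffle = solve-∀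
      combine : ∀ X Y → + deficit X ℤ.+ + deficit Y ≡ sumOver ℓ X ℤ.+ sumOver ℓ Y ℤ.- (ℓ X ℤ.+ ℓ Y)
      combine X Y = trans (sym (cong₂ ℤ._+_ (deficit-correct X) (deficit-correct Y)))
        (shuffle (sumOver ℓ X) (ℓ X) (sumOver ℓ Y) (ℓ Y))

∣∣≡count : ∀ {k} (F : Subset k) → ∣ F ∣ ≡ count (lookup F)
∣∣≡count []          = refl
∣∣≡count (true  ∷ F) = cong suc (∣∣≡count F)
∣∣≡count (false ∷ F) = ∣∣≡count F

-- The two directions of the equivalence

module Decomposition {n m : ℕ} (G : Graph n m) (ℓ : SetFun n)
  (supermodular : TwoIntersectingSupermodular ℓ) (subadditive : WeaklySubadditive ℓ) where

  g : Subset n → ℕ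
  g = deficit ℓ

  open Sparsity G g (deficit-submodular ℓ subadditive supermodular)

  module _ (f : SetFun n) (h : Subset n → ℕ) (f-h : ∀ X → sumOver f X ℤ.- f X ≡ + h X) where

    -- Kept general in `f` and `h` to serve both `ℓ` with `g` and `scale p ℓ` with `p * g`.
    rigid⇒ : ∀ {H} → Rigid f G H →
      ∃ λ F → F ⊆ H × (∀ X → e (lookup F) X ≤ h X) × e (lookup F) ⊤ ≡ h ⊤
    rigid⇒ (F , F⊆H , sparse , size) = F , F⊆H ,
      (λ X → ℤ.drop‿+≤+ (subst₂ ℤ._≤_ (sumFin-𝟙 (λ i → lookup F i ∧ induced X i)) (f-h X) (sparse X))) ,
      trans (e-⊤ (lookup F)) (trans (sym (∣∣≡count F)) (ℤ.+-injective (trans size (f-h ⊤))))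

    rigid⇐ : ∀ {H} (F : EdgeSet) → tabulate F ⊆ H → (∀ X → e F X ≤ h X) → e F ⊤ ≡ h ⊤ → Rigid f G H
    rigid⇐ F F⊆H sparse size = tabulate F , F⊆H ,
      (λ X → subst₂ ℤ._≤_
        (sym (trans (sumFin-𝟙 (λ i → lookup (tabulate F) i ∧ induced X i))
          (cong +_ (e-cong {lookup (tabulate F)} {F} (lookup∘tabulate F) X))))
        (sym (f-h X)) (ℤ.+≤+ (sparse X))) ,
      trans (cong +_ (trans (∣∣≡count (tabulate F)) (trans (count-cong (lookup∘tabulate F))
        (trans (sym (e-⊤ F)) size)))) (sym (f-h ⊤))

  tabulate-⊆ : ∀ {F F′ : EdgeSet} → (∀ i → F i ≡ true → F′ i ≡ true) → tabulate F ⊆ tabulate F′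
  tabulate-⊆ {F} {F′} h {i} i∈ = lookup⇒[]= i _ (trans (lookup∘tabulate F′ i)
    (h i (trans (sym (lookup∘tabulate F i)) ([]=⇒lookup i∈))))

  -- The witness `F` is split by `colourable`. The colouring also assigns the edges outside `F`, so
  -- all edges of `G` are partitioned; spare edges do no harm, as rigidity asks only for a suitable
  -- subset.
  decompose : ∀ {p} → Fin p → Rigid (scale p ℓ) G ⊤ → Decomposable p ℓ G
  decompose {p} j₀ rigid with rigid⇒ (scale p ℓ) (λ X → p * g X) (deficit-scale ℓ subadditive p) rigid
  ... | F , _ , sparse , size = c , λ j →
    rigid⇐ ℓ g (deficit-correct ℓ subadditive) (class (lookup F) c j)
      (tabulate-⊆ λ i h → isYes-true (c i ≟ j) (proj₂ (class-true (lookup F) c h)))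
      (colouring j)
      (sum-saturated (λ j → colouring j ⊤) (trans (e-classes (lookup F) c ⊤) size) j)
    where
    colouring′ = colourable j₀ (lookup F) sparse
    c = proj₁ colouring′
    colouring = proj₂ colouring′
    isYes-true : ∀ {A : Set} (d : Dec A) → A → ⌊ d ⌋ ≡ true
    isYes-true d a = trans (isYes≗does d) (dec-true d a)

  -- The witnesses of the parts are disjoint, so their edge counts, and with them the bounds and
  -- sizes, add up.
  combine : ∀ {p} → Decomposable p ℓ G → Rigid (scale p ℓ) G ⊤
  combine {p} (c , rigid) = rigid⇐ (scale p ℓ) (λ X → p * g X) (deficit-scale ℓ subadditive p)
    F (λ _ → ∈⊤)
    (λ X → subst₂ _≤_ (e-split X) (sum-const p (g X)) (sum-mono λ j → proj₁ (proj₂ (proj₂ (part j))) X))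
    (trans (sym (e-split ⊤)) (trans (sum-cong-≗ λ j → proj₂ (proj₂ (proj₂ (part j)))) (sum-const p (g ⊤))))
    where
    part : ∀ j → _
    part j = rigid⇒ ℓ g (deficit-correct ℓ subadditive) (rigid j)

    Fs : Fin p → EdgeSet
    Fs j = lookup (proj₁ (part j))

    -- The union of the witnesses: by `Fs⊆class` an edge can only be in the witness of its own
    -- colour.
    F : EdgeSet
    F i = Fs (c i) i

    Fs⊆class : ∀ j i → Fs j i ≡ true → c i ≡ j
    Fs⊆class j i h = toWitness (subst T (sym does≡true) tt)
      where
      does≡true : ⌊ c i ≟ j ⌋ ≡ true
      does≡true = trans (sym (lookup∘tabulate _ i))
        ([]=⇒lookup (proj₁ (proj₂ (part j)) (lookup⇒[]= i _ h)))

    class≗Fs : ∀ j → class F c j ≗ Fs j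
    class≗Fs j i with c i ≟ j
    ... | yes refl = ∧-identityʳ (F i)
    ... | no  c≢j  = trans (∧-zeroʳ (F i)) (sym (¬-not (c≢j ∘ Fs⊆class j i)))

    e-split : ∀ X → sum (λ j → e (Fs j) X) ≡ e F X
    e-split X = trans (sym (sum-cong-≗ λ j → e-cong {class F c j} {Fs j} (class≗Fs j) X)) (e-classes F c X)

theorem4p2 : {n m : ℕ} (G : Graph n m) (p : ℕ) → NonZero p → (ℓ : SetFun n) →
    ZeroOnEmpty ℓ → TwoIntersectingSupermodular ℓ → WeaklySubadditive ℓ →
    AdjacencyCondition G ℓ →
    (Rigid (scale p ℓ) G ⊤ ⇔ Decomposable p ℓ G)
theorem4p2 G (suc p) _ ℓ _ supermodular subadditive _ = mk⇔ (decompose zero) combine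
  where open Decomposition G ℓ supermodular subadditive
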